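{- Let $C$ be an (optimal) binary singly even self-dual $[58,29,10]$ code whose shadow $S$ has minimum weight at least $5$, with weight enumerators of $C$ and $S$ of the form $$W_C = 1 +(319 - 24 \beta - 2 \gamma)y^{10} + (3132 + 152 \beta + 2\gamma)y^{12} + \cdots,$$ $$W_S = \beta y^5 + \gamma y^9 + (24128 - 54 \beta - 10 \gamma )y^{13} + (1469952 + 320 \beta + 45 \gamma )y^{17} + \cdots,$$ where $\beta,\gamma$ are integers and the dots denote terms of higher degree. Then $\gamma$ is an even integer.
   Context: All codes are binary: a code of length $n$ is a subspace of $\mathbb{F}_2^n$, and $[n,k,d]$ denotes length $n$, dimension $k$, minimum weight $d$. A code $C$ is self-dual if $C=C^\perp$ with respect to the standard inner product. A self-dual code is singly even if it contains a codeword of weight $\equiv 2 \pmod 4$. For a singly even self-dual code $C$, let $C_0$ be the subcode of codewords of weight $\equiv 0 \pmod 4$; the shadow of $C$ is $S=C_0^\perp\setminus C$. The weight enumerators are $W_C=\sum_i A_i y^i$ and $W_S=\sum_i B_i y^i$, where $A_i$ and $B_i$ are the numbers of vectors of weight $i$ in $C$ and $S$, respectively. A self-dual code is optimal if it has the largest minimum weight among all self-dual codes of its length (for length $58$ this largest minimum weight is $10$). It is known that every singly even self-dual $[58,29,10]$ code with shadow of minimum weight at least $5$ has weight enumerators of the displayed form for some integers $\beta,\gamma$. -}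

module Defs where

open import Level using (0ℓ)
open import Data.Bool.Base using (Bool; true; false; _∧_; _xor_; if_then_else_)
import Data.Bool.Properties as Bool
open import Data.Fin.Subset using (∣_∣)
open import Data.Fin.Subset.Properties using (anySubset?)
open import Data.Integer.Base as ℤ using (ℤ; +_)
open import Data.List.Base using (List; [_]; _++_; map; filter; length)
open import Data.Nat.Base using (ℕ; zero; suc; _≤_; _<_; _≡ᵇ_; _%_)
import Data.Nat.Properties as ℕ
open import Data.Product.Base using (Σ; ∃; _×_; _,_)
open import Data.Vec.Base as Vec using (Vec; []; _∷_; zipWith; replicate; lookup)
open import Relation.Binary.PropositionalEquality using (_≡_; _≢_)
open import Relation.Nullary.Decidable using (map′; ¬?; _×-dec_; decidable-stable)
open import Relation.Unary using (Pred; Decidable; _∈_; _≐_; _∖_)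

-- The field F₂, with addition _xor_ and multiplication _∧_.
F₂ : Set
F₂ = Bool

-- Definitionally equal to Subset n, a vector being identified with its
-- support.
F₂^_ : ℕ → Set
F₂^ n = Vec F₂ n

module _ {n : ℕ} where

  infixl 6 _⊕_
  infixr 7 _·_

  0# : F₂^ n
  0# = replicate n false

  _⊕_ : F₂^ n → F₂^ n → F₂^ n
  _⊕_ = zipWith _xor_

  _·_ : F₂ → F₂^ n → F₂^ n
  a · x = Vec.map (a ∧_) x

  ⟨_,_⟩ : F₂^ n → F₂^ n → F₂
  ⟨ x , y ⟩ = Vec.foldr′ _xor_ false (zipWith _∧_ x y)

  wt : F₂^ n → ℕ
  wt x = ∣ x ∣

  linearCombination : ∀ {k} → F₂^ k → Vec (F₂^ n) k → F₂^ n
  linearCombination a b = Vec.foldr′ _⊕_ 0# (zipWith _·_ a b)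

  infix 10 _⊥

  _⊥ : Pred (F₂^ n) 0ℓ → Pred (F₂^ n) 0ℓ
  (P ⊥) v = ∀ x → x ∈ P → ⟨ x , v ⟩ ≡ false

  ⊥? : ∀ {P : Pred (F₂^ n) 0ℓ} → Decidable P → Decidable (P ⊥)
  ⊥? P? v =
    map′
      (λ none x x∈P → decidable-stable (⟨ x , v ⟩ Bool.≟ false)
                        (λ ≢0 → none (x , x∈P , ≢0)))
      (λ v∈P⊥ (x , x∈P , ≢0) → ≢0 (v∈P⊥ x x∈P))
      (¬? (anySubset? (λ x → P? x ×-dec ¬? (⟨ x , v ⟩ Bool.≟ false))))

-- Over F₂, closure under scalar multiplication follows from the two
-- closure conditions below.  Membership is decidable, as it is classically
-- for any subset of a finite set, so that codewords can be counted.
record Code (n : ℕ) : Set₁ where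
  field
    Codeword  : Pred (F₂^ n) 0ℓ
    codeword? : Decidable Codeword
    0-closed  : 0# ∈ Codeword
    ⊕-closed  : ∀ {x y} → x ∈ Codeword → y ∈ Codeword → x ⊕ y ∈ Codeword

open Code public

module _ {n : ℕ} where

  IsBasis : ∀ {k} → Code n → Vec (F₂^ n) k → Set
  IsBasis {k} C b =
      (∀ i → lookup b i ∈ Codeword C)
    × (∀ a → linearCombination a b ≡ 0# → a ≡ 0#)
    × (∀ x → x ∈ Codeword C → ∃ λ a → linearCombination a b ≡ x)

  HasDimension : Code n → ℕ → Set
  HasDimension C k = Σ (Vec (F₂^ n) k) (IsBasis C)

  HasMinimumWeight : Code n → ℕ → Set
  HasMinimumWeight C d =
      (∃ λ x → x ∈ Codeword C × x ≢ 0# × wt x ≡ d)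
    × (∀ x → x ∈ Codeword C → x ≢ 0# → d ≤ wt x)

  SelfDual : Code n → Set
  SelfDual C = Codeword C ≐ Codeword C ⊥

  Optimal : Code n → Set₁
  Optimal C = ∀ d → HasMinimumWeight C d →
    ∀ (D : Code n) → SelfDual D → ∀ d′ → HasMinimumWeight D d′ → d′ ≤ d

  SinglyEven : Code n → Set
  SinglyEven C = ∃ λ x → x ∈ Codeword C × wt x % 4 ≡ 2

  DoublyEvenSubcode : Code n → Pred (F₂^ n) 0ℓ
  DoublyEvenSubcode C x = x ∈ Codeword C × wt x % 4 ≡ 0

  doublyEvenSubcode? : ∀ C → Decidable (DoublyEvenSubcode C)
  doublyEvenSubcode? C x = codeword? C x ×-dec (wt x % 4 ℕ.≟ 0)

  Shadow : Code n → Pred (F₂^ n) 0ℓ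
  Shadow C = DoublyEvenSubcode C ⊥ ∖ Codeword C

  shadow? : ∀ C → Decidable (Shadow C)
  shadow? C x = ⊥? (doublyEvenSubcode? C) x ×-dec ¬? (codeword? C x)

allVectors : ∀ n → List (F₂^ n)
allVectors zero    = [ [] ]
allVectors (suc n) =
  map (false ∷_) (allVectors n) ++ map (true ∷_) (allVectors n)

countOfWeight : ∀ {n} {P : Pred (F₂^ n) 0ℓ} → Decidable P → ℕ → ℕ
countOfWeight {n} P? i =
  length (filter (λ x → P? x ×-dec (wt x ℕ.≟ i)) (allVectors n))

-- Polynomials and power series in y, as their coefficient sequences.
ℤ[[y]] : Set
ℤ[[y]] = ℕ → ℤ

infix  8 _y^_
infixl 6 _⊞_
infix  4 _≈_+O[y^_]

_y^_ : ℤ → ℕ → ℤ[[y]]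
(c y^ d) i = if i ≡ᵇ d then c else + 0

_⊞_ : ℤ[[y]] → ℤ[[y]] → ℤ[[y]]
(f ⊞ g) i = f i ℤ.+ g i

_≈_+O[y^_] : ℤ[[y]] → ℤ[[y]] → ℕ → Set
f ≈ g +O[y^ d ] = ∀ i → i < d → f i ≡ g i

weightEnumerator : ∀ {n} {P : Pred (F₂^ n) 0ℓ} → Decidable P → ℤ[[y]]
weightEnumerator P? i = + countOfWeight P? i

{-# OPTIONS --safe #-}

-- If S is nonempty, it is a coset s + C, because ⟨ c , s ⟩ is the parity of
-- wt c / 2 for every c ∈ C.  For s ∈ S of weight 9 the function
-- f(x) = [x ∈ S] (-1)^⟨s,x⟩ (signed below) is an eigenvector of the Fourier transform with
-- eigenvalue - ∣C∣, and f(1 + x) = - f(x); moreover S lives on the weights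
-- 5, 9, …, 53.  Let D_i be the sum of f over the vectors of weight i.  Pairing f
-- with the weight function δ₉ + 10 δ₅ + 55 δ₁, whose transform is the combination
-- K₉ + 10 K₅ + 55 K₁ of Krawtchouk polynomials, gives
--   - ∣C∣ (D₉ + 10 D₅) = 2²⁷ (D₉ - D₄₉ + 10 (D₅ - D₅₃)) = 2²⁸ (D₉ + 10 D₅),
-- so that D₉ = - 10 D₅ is even.  Since f is ± 1 on S, γ ≡ D₉ (mod 2).
module Submission where

open import Defs
import Data.Integer.Properties as ℤ
import Data.Nat.Properties as ℕ
open import Algebra.Properties.CommutativeSemigroup ℤ.+-commutativeSemigroup using (interchange)
open import Algebra.Properties.CommutativeSemigroup ℤ.*-commutativeSemigroup using (x∙yz≈y∙xz)
open import Data.Bool.Base using (Bool; true; false; not; _∧_; _xor_; if_then_else_)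
import Data.Bool.Properties as Bool
open import Data.Bool.Solver using (module xor-∧-Solver)
open import Data.Fin.Base using (Fin; toℕ; fromℕ<)
open import Data.Fin.Properties using (all?; toℕ-fromℕ<)
open import Data.Fin.Subset using (_∩_)
open import Data.Fin.Subset.Properties using (anySubset?; ∩-idem; ∩-identityʳ)
open import Data.Integer.Base using (ℤ; +_; -_; _+_; _-_; _*_; 0ℤ; 1ℤ; -1ℤ)
open import Data.Integer.Divisibility using (_∣_)
import Data.Integer.Divisibility.Signed as Signed
open import Data.Integer.Tactic.RingSolver using (solve-∀)
open import Data.List.Base using (List; []; _∷_; length; filter; map; _++_)
open import Data.List.Properties using (filter-++; length-++)
open import Data.Nat.Base as ℕ using (ℕ; zero; suc; _≤_; _<_; _%_)
open import Data.Nat.DivMod using ([m+kn]%n≡m%n)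
open import Data.Nat.GeneralisedArithmetic using (fold)
import Data.Nat.Tactic.RingSolver as ℕ-Ring
open import Data.Product.Base using (∃; _×_; _,_; proj₁; proj₂)
open import Data.Vec.Base using ([]; _∷_; replicate)
open import Data.Vec.Properties using (zipWith-assoc; zipWith-comm)
open import Function.Base using (_∘_; case_of_)
open import Function.Bundles using (mk⇔)
open import Level using (0ℓ)
open import Relation.Binary.PropositionalEquality
open import Relation.Nullary using (Dec; yes; no; does; ¬_; contradiction)
open import Relation.Nullary.Decidable using (_×-dec_; _→-dec_; map′; does-⇔; from-yes; dec-true; dec-false)
open import Relation.Unary using (Pred; Decidable; _∈_)

private
  variable
    n : ℕ

-- Sums of integer functions over all binary vectors.

∑ : (F₂^ n → ℤ) → ℤ
∑ {zero}  g = g []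
∑ {suc n} g = ∑ (g ∘ (false ∷_)) + ∑ (g ∘ (true ∷_))

∑-cong : ∀ {g h : F₂^ n → ℤ} → (∀ x → g x ≡ h x) → ∑ g ≡ ∑ h
∑-cong {zero}  g≗h = g≗h []
∑-cong {suc n} g≗h = cong₂ _+_ (∑-cong (g≗h ∘ (false ∷_))) (∑-cong (g≗h ∘ (true ∷_)))

∑-distrib-+ : ∀ (g h : F₂^ n → ℤ) → ∑ (λ x → g x + h x) ≡ ∑ g + ∑ h
∑-distrib-+ {zero}  g h = refl
∑-distrib-+ {suc n} g h = trans
  (cong₂ _+_ (∑-distrib-+ (g ∘ (false ∷_)) _) (∑-distrib-+ (g ∘ (true ∷_)) _))
  (interchange (∑ (g ∘ (false ∷_))) (∑ (h ∘ (false ∷_))) (∑ (g ∘ (true ∷_))) (∑ (h ∘ (true ∷_))))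

*-distribˡ-∑ : ∀ i (g : F₂^ n → ℤ) → i * ∑ g ≡ ∑ (λ x → i * g x)
*-distribˡ-∑ {zero}  i g = refl
*-distribˡ-∑ {suc n} i g = trans (ℤ.*-distribˡ-+ i _ _)
  (cong₂ _+_ (*-distribˡ-∑ i (g ∘ (false ∷_))) (*-distribˡ-∑ i (g ∘ (true ∷_))))

∑-swap : ∀ {m} (g : F₂^ m → F₂^ n → ℤ) → ∑ (λ x → ∑ (g x)) ≡ ∑ (λ y → ∑ (λ x → g x y))
∑-swap {m = zero}  g = refl
∑-swap {m = suc m} g = trans
  (cong₂ _+_ (∑-swap (g ∘ (false ∷_))) (∑-swap (g ∘ (true ∷_))))
  (sym (∑-distrib-+ (λ y → ∑ (λ x → g (false ∷ x) y)) _))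

-- A true coordinate of `y` merely exchanges the two halves of the sum.
∑-translate : ∀ (y : F₂^ n) (g : F₂^ n → ℤ) → ∑ (λ x → g (x ⊕ y)) ≡ ∑ g
∑-translate []          g = refl
∑-translate (false ∷ y) g =
  cong₂ _+_ (∑-translate y (g ∘ (false ∷_))) (∑-translate y (g ∘ (true ∷_)))
∑-translate (true ∷ y)  g = trans
  (cong₂ _+_ (∑-translate y (g ∘ (true ∷_))) (∑-translate y (g ∘ (false ∷_))))
  (ℤ.+-comm (∑ (g ∘ (true ∷_))) (∑ (g ∘ (false ∷_))))

∑-∣ : ∀ i {g : F₂^ n → ℤ} → (∀ x → i Signed.∣ g x) → i Signed.∣ ∑ g
∑-∣ {zero}  i i∣g = i∣g []
∑-∣ {suc n} i i∣g =
  Signed.∣m∣n⇒∣m+n (∑-∣ i (i∣g ∘ (false ∷_))) (∑-∣ i (i∣g ∘ (true ∷_)))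

-- Indicators and counting.

𝟙 : ∀ {p} {P : Set p} → Dec P → ℤ
𝟙 P? = if does P? then 1ℤ else 0ℤ

𝟙-⇔ : ∀ {P Q : Set} (P? : Dec P) (Q? : Dec Q) → (P → Q) → (Q → P) → 𝟙 P? ≡ 𝟙 Q?
𝟙-⇔ P? Q? P→Q Q→P = cong (if_then 1ℤ else 0ℤ) (does-⇔ (mk⇔ P→Q Q→P) P? Q?)

𝟙-true : ∀ {P : Set} (P? : Dec P) → P → 𝟙 P? ≡ 1ℤ
𝟙-true P? p = cong (if_then 1ℤ else 0ℤ) (dec-true P? p)

𝟙-false : ∀ {P : Set} (P? : Dec P) → ¬ P → 𝟙 P? ≡ 0ℤ
𝟙-false P? ¬p = cong (if_then 1ℤ else 0ℤ) (dec-false P? ¬p)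

length-filter-map : ∀ {A B : Set} {P : Pred B 0ℓ} (P? : Decidable P) (f : A → B) xs →
  length (filter P? (map f xs)) ≡ length (filter (P? ∘ f) xs)
length-filter-map P? f []       = refl
length-filter-map P? f (x ∷ xs) with does (P? (f x))
... | true  = cong suc (length-filter-map P? f xs)
... | false = length-filter-map P? f xs

-- `allVectors` and `∑` split along the first coordinate in the same way. This turns `countOfWeight`
-- and the number of codewords into sums.
length-filter-allVectors : ∀ {P : Pred (F₂^ n) 0ℓ} (P? : Decidable P) →
  + length (filter P? (allVectors n)) ≡ ∑ (λ x → 𝟙 (P? x))
length-filter-allVectors {zero} P? with does (P? [])
... | true  = refl
... | false = refl
length-filter-allVectors {suc n} P? = begin
  + length (filter P? (map (false ∷_) xs ++ map (true ∷_) xs))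
    ≡⟨ cong (+_ ∘ length) (filter-++ P? (map (false ∷_) xs) _) ⟩
  + length (filter P? (map (false ∷_) xs) ++ filter P? (map (true ∷_) xs))
    ≡⟨ cong +_ (length-++ (filter P? (map (false ∷_) xs))) ⟩
  + length (filter P? (map (false ∷_) xs)) + + length (filter P? (map (true ∷_) xs))
    ≡⟨ cong₂ (λ i j → + i + + j) (length-filter-map P? (false ∷_) xs)
                                 (length-filter-map P? (true ∷_) xs) ⟩
  + length (filter (P? ∘ (false ∷_)) xs) + + length (filter (P? ∘ (true ∷_)) xs)
    ≡⟨ cong₂ _+_ (length-filter-allVectors (P? ∘ (false ∷_)))
                 (length-filter-allVectors (P? ∘ (true ∷_))) ⟩
  ∑ (λ x → 𝟙 (P? x)) ∎
  where
  open ≡-Reasoning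
  xs = allVectors n

-- Vector addition, weights and parity.

⊕-cancelʳ : ∀ (x y : F₂^ n) → (x ⊕ y) ⊕ y ≡ x
⊕-cancelʳ []      []      = refl
⊕-cancelʳ (a ∷ x) (b ∷ y) = cong₂ _∷_
  (trans (Bool.xor-assoc a b b) (trans (cong (a xor_) (Bool.xor-same b)) (Bool.xor-identityʳ a)))
  (⊕-cancelʳ x y)

⊕-exchangeʳ : ∀ (x y z : F₂^ n) → (x ⊕ y) ⊕ z ≡ (x ⊕ z) ⊕ y
⊕-exchangeʳ x y z = begin
  (x ⊕ y) ⊕ z ≡⟨ zipWith-assoc Bool.xor-assoc x y z ⟩
  x ⊕ (y ⊕ z) ≡⟨ cong (x ⊕_) (zipWith-comm Bool.xor-comm y z) ⟩
  x ⊕ (z ⊕ y) ≡⟨ zipWith-assoc Bool.xor-assoc x z y ⟨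
  (x ⊕ z) ⊕ y ∎
  where open ≡-Reasoning

ones : F₂^ n
ones = replicate _ true

wt-complement : ∀ (x : F₂^ n) → wt x ℕ.+ wt (x ⊕ ones) ≡ n
wt-complement []          = refl
wt-complement (false ∷ x) = trans (ℕ.+-suc (wt x) _) (cong suc (wt-complement x))
wt-complement (true ∷ x)  = cong suc (wt-complement x)

odd : ℕ → Bool
odd zero    = false
odd (suc n) = not (odd n)

odd-+ : ∀ m n → odd (m ℕ.+ n) ≡ odd m xor odd n
odd-+ zero    n = refl
odd-+ (suc m) n = trans (cong not (odd-+ m n)) (Bool.not-distribˡ-xor (odd m) (odd n))

odd≡false⇒even : ∀ n → odd n ≡ false → ∃ λ k → n ≡ k ℕ.* 2
odd≡false⇒even zero          _    = 0 , refl
odd≡false⇒even (suc (suc n)) eq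
  with odd≡false⇒even n (trans (sym (Bool.not-involutive (odd n))) eq)
... | k , n≡k*2 = suc k , cong (suc ∘ suc) n≡k*2

-- Raising `k` by two raises `k * 2` by four, which `_% 4` absorbs by computation.
[k*2]%4≡0⇒odd≡false : ∀ k → (k ℕ.* 2) % 4 ≡ 0 → odd k ≡ false
[k*2]%4≡0⇒odd≡false zero          _  = refl
[k*2]%4≡0⇒odd≡false (suc (suc k)) eq =
  trans (Bool.not-involutive (odd k)) ([k*2]%4≡0⇒odd≡false k eq)

odd≡false⇒[k*2]%4≡0 : ∀ k → odd k ≡ false → (k ℕ.* 2) % 4 ≡ 0
odd≡false⇒[k*2]%4≡0 zero          _  = refl
odd≡false⇒[k*2]%4≡0 (suc (suc k)) eq =
  odd≡false⇒[k*2]%4≡0 k (trans (sym (Bool.not-involutive (odd k))) eq)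

-- Positions in both supports count twice on the right and cancel in `x ⊕ y`.
wt-⊕ : ∀ (x y : F₂^ n) → wt (x ⊕ y) ℕ.+ wt (x ∩ y) ℕ.* 2 ≡ wt x ℕ.+ wt y
wt-⊕ []          []          = refl
wt-⊕ (false ∷ x) (false ∷ y) = wt-⊕ x y
wt-⊕ (false ∷ x) (true ∷ y)  = trans (cong suc (wt-⊕ x y)) (sym (ℕ.+-suc (wt x) (wt y)))
wt-⊕ (true ∷ x)  (false ∷ y) = cong suc (wt-⊕ x y)
wt-⊕ (true ∷ x)  (true ∷ y)  = begin
  wt (x ⊕ y) ℕ.+ suc (suc (wt (x ∩ y) ℕ.* 2)) ≡⟨ ℕ.+-suc (wt (x ⊕ y)) _ ⟩
  suc (wt (x ⊕ y) ℕ.+ suc (wt (x ∩ y) ℕ.* 2)) ≡⟨ cong suc (ℕ.+-suc (wt (x ⊕ y)) _) ⟩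
  suc (suc (wt (x ⊕ y) ℕ.+ wt (x ∩ y) ℕ.* 2)) ≡⟨ cong (suc ∘ suc) (wt-⊕ x y) ⟩
  suc (suc (wt x ℕ.+ wt y))                   ≡⟨ cong suc (ℕ.+-suc (wt x) (wt y)) ⟨
  suc (wt x ℕ.+ suc (wt y))                   ∎
  where open ≡-Reasoning

-- The inner product.

⟨⟩-odd : ∀ (x y : F₂^ n) → ⟨ x , y ⟩ ≡ odd (wt (x ∩ y))
⟨⟩-odd []          []          = refl
⟨⟩-odd (false ∷ x) (_ ∷ y)     = ⟨⟩-odd x y
⟨⟩-odd (true ∷ x)  (false ∷ y) = ⟨⟩-odd x y
⟨⟩-odd (true ∷ x)  (true ∷ y)  = cong not (⟨⟩-odd x y)

⟨⟩-self : ∀ (x : F₂^ n) → ⟨ x , x ⟩ ≡ odd (wt x)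
⟨⟩-self x = trans (⟨⟩-odd x x) (cong (odd ∘ wt) (∩-idem x))

⟨⟩-ones : ∀ (x : F₂^ n) → ⟨ x , ones ⟩ ≡ odd (wt x)
⟨⟩-ones x = trans (⟨⟩-odd x ones) (cong (odd ∘ wt) (∩-identityʳ x))

⟨⟩-comm : ∀ (x y : F₂^ n) → ⟨ x , y ⟩ ≡ ⟨ y , x ⟩
⟨⟩-comm []      []      = refl
⟨⟩-comm (a ∷ x) (b ∷ y) = cong₂ _xor_ (Bool.∧-comm a b) (⟨⟩-comm x y)

⟨⟩-distribʳ-⊕ : ∀ (z x y : F₂^ n) → ⟨ x ⊕ y , z ⟩ ≡ ⟨ x , z ⟩ xor ⟨ y , z ⟩
⟨⟩-distribʳ-⊕ []      []      []      = refl
⟨⟩-distribʳ-⊕ (c ∷ z) (a ∷ x) (b ∷ y) = trans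
  (cong (((a xor b) ∧ c) xor_) (⟨⟩-distribʳ-⊕ z x y))
  (solve 5 (λ a b c p q → (a :+ b) :* c :+ (p :+ q) := (a :* c :+ p) :+ (b :* c :+ q)) refl
    a b c ⟨ x , z ⟩ ⟨ y , z ⟩)
  where open xor-∧-Solver

⟨⟩-distribˡ-⊕ : ∀ (z x y : F₂^ n) → ⟨ z , x ⊕ y ⟩ ≡ ⟨ z , x ⟩ xor ⟨ z , y ⟩
⟨⟩-distribˡ-⊕ z x y = trans (⟨⟩-comm z (x ⊕ y))
  (trans (⟨⟩-distribʳ-⊕ z x y) (cong₂ _xor_ (⟨⟩-comm x z) (⟨⟩-comm y z)))

-- Characters and the Fourier transform.

χ : F₂ → ℤ
χ b = if b then -1ℤ else 1ℤ

χ-xor : ∀ a b → χ (a xor b) ≡ χ a * χ b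
χ-xor false false = refl
χ-xor false true  = refl
χ-xor true  false = refl
χ-xor true  true  = refl

𝓕 : (F₂^ n → ℤ) → F₂^ n → ℤ
𝓕 g z = ∑ (λ x → g x * χ ⟨ x , z ⟩)

-- The kernel `χ ⟨ x , z ⟩` is symmetric, so it suffices to exchange the two sums.
𝓕-adjoint : ∀ (g h : F₂^ n → ℤ) → ∑ (λ z → g z * 𝓕 h z) ≡ ∑ (λ x → h x * 𝓕 g x)
𝓕-adjoint g h = begin
  ∑ (λ z → g z * 𝓕 h z)
    ≡⟨ ∑-cong (λ z → *-distribˡ-∑ (g z) (λ x → h x * χ ⟨ x , z ⟩)) ⟩
  ∑ (λ z → ∑ (λ x → g z * (h x * χ ⟨ x , z ⟩)))
    ≡⟨ ∑-swap (λ z x → g z * (h x * χ ⟨ x , z ⟩)) ⟩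
  ∑ (λ x → ∑ (λ z → g z * (h x * χ ⟨ x , z ⟩)))
    ≡⟨ ∑-cong (λ x → ∑-cong (λ z → trans (x∙yz≈y∙xz (g z) (h x) _)
         (cong (λ b → h x * (g z * χ b)) (⟨⟩-comm x z)))) ⟩
  ∑ (λ x → ∑ (λ z → h x * (g z * χ ⟨ z , x ⟩)))
    ≡⟨ ∑-cong (λ x → *-distribˡ-∑ (h x) (λ z → g z * χ ⟨ z , x ⟩)) ⟨
  ∑ (λ x → h x * 𝓕 g x) ∎
  where open ≡-Reasoning

-- Transforms of weight functions and Krawtchouk polynomials.

-- A list as stands for the weight function k ↦ coeff as k, which is zero past
-- the end of the list.  Summing out one coordinate of its transform 𝓕 replaces
-- it by step (± 1) as, with the sign given by that coordinate of the argument;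
-- since the steps commute, only the weight of the argument matters.
coeff : List ℤ → ℕ → ℤ
coeff []       _       = 0ℤ
coeff (a ∷ as) zero    = a
coeff (a ∷ as) (suc k) = coeff as k

step : ℤ → List ℤ → List ℤ
step e []       = []
step e (a ∷ as) = a + e * coeff as 0 ∷ step e as

coeff-step : ∀ e as k → coeff (step e as) k ≡ coeff as k + e * coeff as (suc k)
coeff-step e []       k       = sym (trans (ℤ.+-identityˡ _) (ℤ.*-zeroʳ e))
coeff-step e (a ∷ as) zero    = refl
coeff-step e (a ∷ as) (suc k) = coeff-step e as k

-- `step e` is the identity plus `e` times a shift, and polynomials in one operator commute.
step-comm : ∀ d e as → step d (step e as) ≡ step e (step d as)
step-comm d e []       = refl
step-comm d e (a ∷ as) = cong₂ _∷_ eq (step-comm d e as)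
  where
  open ≡-Reasoning
  lemma : ∀ a b c d e → (a + e * b) + d * (b + e * c) ≡ (a + d * b) + e * (b + d * c)
  lemma = solve-∀
  eq : (a + e * coeff as 0) + d * coeff (step e as) 0 ≡ (a + d * coeff as 0) + e * coeff (step d as) 0
  eq = begin
    (a + e * coeff as 0) + d * coeff (step e as) 0
      ≡⟨ cong (λ i → (a + e * coeff as 0) + d * i) (coeff-step e as 0) ⟩
    (a + e * coeff as 0) + d * (coeff as 0 + e * coeff as 1)
      ≡⟨ lemma a _ _ d e ⟩
    (a + d * coeff as 0) + e * (coeff as 0 + d * coeff as 1)
      ≡⟨ cong (λ i → (a + d * coeff as 0) + e * i) (coeff-step d as 0) ⟨
    (a + d * coeff as 0) + e * coeff (step d as) 0 ∎

-- If as is the indicator of weight k, the head of krawtchouk as m i is the value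
-- at i of the Krawtchouk polynomial Kₖ for length m + i.
krawtchouk : List ℤ → ℕ → ℕ → List ℤ
krawtchouk as m i = fold (fold as (step -1ℤ) i) (step 1ℤ) m

step-krawtchouk : ∀ e as m i → krawtchouk (step e as) m i ≡ step e (krawtchouk as m i)
step-krawtchouk e as zero    zero    = refl
step-krawtchouk e as zero    (suc i) =
  trans (cong (step -1ℤ) (step-krawtchouk e as zero i)) (step-comm -1ℤ e _)
step-krawtchouk e as (suc m) i       =
  trans (cong (step 1ℤ) (step-krawtchouk e as m i)) (step-comm 1ℤ e _)

-- Steps of sign `-1ℤ` are innermost, so the new one is moved past the `m` steps of sign `1ℤ`.
krawtchouk-sucʳ : ∀ as m i → step -1ℤ (krawtchouk as m i) ≡ krawtchouk as m (suc i)
krawtchouk-sucʳ as zero    i = refl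
krawtchouk-sucʳ as (suc m) i =
  trans (step-comm -1ℤ 1ℤ (krawtchouk as m i)) (cong (step 1ℤ) (krawtchouk-sucʳ as m i))

-- Induction on the coordinates: summing out the first one replaces `as` by `step (χ b) as`. At the
-- end only the empty vector is left, of weight zero, hence the coefficient at 0.
𝓕-krawtchouk : ∀ as (x : F₂^ n) →
  𝓕 (coeff as ∘ wt) x ≡ coeff (krawtchouk as (wt (x ⊕ ones)) (wt x)) 0
𝓕-krawtchouk as []      = ℤ.*-identityʳ (coeff as 0)
𝓕-krawtchouk as (b ∷ x) = begin
  ∑ (λ z → coeff as (wt z) * χ ⟨ z , x ⟩) + ∑ (λ z → coeff as (suc (wt z)) * χ (b xor ⟨ z , x ⟩))
    ≡⟨ ∑-distrib-+ (λ z → coeff as (wt z) * χ ⟨ z , x ⟩) _ ⟨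
  ∑ (λ z → coeff as (wt z) * χ ⟨ z , x ⟩ + coeff as (suc (wt z)) * χ (b xor ⟨ z , x ⟩))
    ≡⟨ ∑-cong (λ z → trans
         (cong (λ i → coeff as (wt z) * χ ⟨ z , x ⟩ + coeff as (suc (wt z)) * i) (χ-xor b ⟨ z , x ⟩))
         (trans (lemma (coeff as (wt z)) (coeff as (suc (wt z))) (χ b) (χ ⟨ z , x ⟩))
                (cong (_* χ ⟨ z , x ⟩) (sym (coeff-step (χ b) as (wt z)))))) ⟩
  𝓕 (coeff (step (χ b) as) ∘ wt) x
    ≡⟨ 𝓕-krawtchouk (step (χ b) as) x ⟩
  coeff (krawtchouk (step (χ b) as) (wt (x ⊕ ones)) (wt x)) 0
    ≡⟨ cong (λ as → coeff as 0) (trans (step-krawtchouk (χ b) as (wt (x ⊕ ones)) (wt x)) (shift b)) ⟩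
  coeff (krawtchouk as (wt ((b ∷ x) ⊕ ones)) (wt (b ∷ x))) 0 ∎
  where
  open ≡-Reasoning
  lemma : ∀ p q r s → p * s + q * (r * s) ≡ (p + r * q) * s
  lemma = solve-∀
  -- A false coordinate lengthens the outer `fold`, so it holds by computation; a true one has to be
  -- moved inside.
  shift : ∀ b → step (χ b) (krawtchouk as (wt (x ⊕ ones)) (wt x)) ≡
                krawtchouk as (wt ((b ∷ x) ⊕ ones)) (wt (b ∷ x))
  shift false = refl
  shift true  = krawtchouk-sucʳ as (wt (x ⊕ ones)) (wt x)

-- Self-dual codes and their shadows.

module SelfDualCode {n} (C : Code n) (selfDual : SelfDual C) where

  indicator : F₂^ n → ℤ
  indicator x = 𝟙 (codeword? C x)

  size : ℤ
  size = ∑ indicator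

  orthogonal : ∀ {x y} → x ∈ Codeword C → y ∈ Codeword C → ⟨ x , y ⟩ ≡ false
  orthogonal x∈C y∈C = proj₁ selfDual y∈C _ x∈C

  -- The contrapositive of `C ⊥ ⊆ C`; an exhaustive search supplies the witness.
  ∉⇒nonorthogonal : ∀ {x} → ¬ (x ∈ Codeword C) → ∃ λ c → c ∈ Codeword C × ⟨ c , x ⟩ ≡ true
  ∉⇒nonorthogonal {x} x∉C
    with anySubset? (λ c → codeword? C c ×-dec (⟨ c , x ⟩ Bool.≟ true))
  ... | yes nonorthogonal = nonorthogonal
  ... | no  none          = contradiction
    (proj₂ selfDual λ c c∈C → Bool.¬-not λ eq → none (c , c∈C , eq)) x∉C

  even-weight : ∀ {c} → c ∈ Codeword C → odd (wt c) ≡ false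
  even-weight {c} c∈C = trans (sym (⟨⟩-self c)) (orthogonal c∈C c∈C)

  half-weight : ∀ {c} → c ∈ Codeword C → ∃ λ k → wt c ≡ k ℕ.* 2
  half-weight c∈C = odd≡false⇒even _ (even-weight c∈C)

  -- Pairing with `ones` gives the parity of the weight, so `ones` is orthogonal to all codewords.
  ones∈C : ones ∈ Codeword C
  ones∈C = proj₂ selfDual λ c c∈C → trans (⟨⟩-ones c) (even-weight c∈C)

  ⊕-cancelʳ-∈ : ∀ {x c} → c ∈ Codeword C → x ⊕ c ∈ Codeword C → x ∈ Codeword C
  ⊕-cancelʳ-∈ {x} {c} c∈C x⊕c∈C =
    subst (Codeword C) (⊕-cancelʳ x c) (⊕-closed C x⊕c∈C c∈C)

  indicator-translate : ∀ {c} x → c ∈ Codeword C → indicator (x ⊕ c) ≡ indicator x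
  indicator-translate {c} x c∈C = 𝟙-⇔ (codeword? C (x ⊕ c)) (codeword? C x)
    (⊕-cancelʳ-∈ c∈C) (λ x∈C → ⊕-closed C x∈C c∈C)

  -- If `z` is a codeword, every character value on `C` is 1. Otherwise some codeword `c` has
  -- `⟨ c , z ⟩ ≡ true`, and translation by `c` negates the sum, which must vanish.
  𝓕-indicator : ∀ z → 𝓕 indicator z ≡ size * indicator z
  𝓕-indicator z with codeword? C z
  ... | yes z∈C = trans (∑-cong term) (sym (ℤ.*-identityʳ size))
    where
    term : ∀ x → indicator x * χ ⟨ x , z ⟩ ≡ indicator x
    term x with codeword? C x
    ... | yes x∈C = cong (λ b → 1ℤ * χ b) (orthogonal x∈C z∈C)
    ... | no  _   = refl
  ... | no z∉C = trans (i≡-i⇒i≡0 eq) (sym (ℤ.*-zeroʳ size))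
    where
    open ≡-Reasoning
    i≡-i⇒i≡0 : ∀ {i} → i ≡ -1ℤ * i → i ≡ 0ℤ
    -- For any other integer the two sides have opposite signs by computation.
    i≡-i⇒i≡0 {+ zero} _ = refl
    c = proj₁ (∉⇒nonorthogonal z∉C)
    c∈C = proj₁ (proj₂ (∉⇒nonorthogonal z∉C))
    ⟨c,z⟩≡1 = proj₂ (proj₂ (∉⇒nonorthogonal z∉C))
    flip : ∀ i j → i * (j * -1ℤ) ≡ -1ℤ * (i * j)
    flip = solve-∀
    term : ∀ x → indicator (x ⊕ c) * χ ⟨ x ⊕ c , z ⟩ ≡ -1ℤ * (indicator x * χ ⟨ x , z ⟩)
    term x = begin
      indicator (x ⊕ c) * χ ⟨ x ⊕ c , z ⟩
        ≡⟨ cong₂ _*_ (indicator-translate x c∈C) (cong χ (⟨⟩-distribʳ-⊕ z x c)) ⟩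
      indicator x * χ (⟨ x , z ⟩ xor ⟨ c , z ⟩)
        ≡⟨ cong (λ i → indicator x * i) (χ-xor ⟨ x , z ⟩ ⟨ c , z ⟩) ⟩
      indicator x * (χ ⟨ x , z ⟩ * χ ⟨ c , z ⟩)
        ≡⟨ cong (λ b → indicator x * (χ ⟨ x , z ⟩ * χ b)) ⟨c,z⟩≡1 ⟩
      indicator x * (χ ⟨ x , z ⟩ * -1ℤ)
        ≡⟨ flip (indicator x) (χ ⟨ x , z ⟩) ⟩
      -1ℤ * (indicator x * χ ⟨ x , z ⟩) ∎
    eq : 𝓕 indicator z ≡ -1ℤ * 𝓕 indicator z
    eq = begin
      𝓕 indicator z
        ≡⟨ ∑-translate c (λ x → indicator x * χ ⟨ x , z ⟩) ⟨
      ∑ (λ x → indicator (x ⊕ c) * χ ⟨ x ⊕ c , z ⟩)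
        ≡⟨ ∑-cong term ⟩
      ∑ (λ x → -1ℤ * (indicator x * χ ⟨ x , z ⟩))
        ≡⟨ *-distribˡ-∑ -1ℤ (λ x → indicator x * χ ⟨ x , z ⟩) ⟨
      -1ℤ * 𝓕 indicator z ∎

  -- For even `k`, `c` is in the doubly even subcode. For odd `k`, take a codeword `d` not
  -- orthogonal to `s`: its half-weight is odd too, so `c ⊕ d` is doubly even, hence orthogonal to
  -- `s`, and `c` pairs with `s` as `d` does.
  shadow-⟨⟩ : ∀ {s c} k → s ∈ Shadow C → c ∈ Codeword C → wt c ≡ k ℕ.* 2 → ⟨ c , s ⟩ ≡ odd k
  shadow-⟨⟩ {s} {c} k (s∈C₀⊥ , s∉C) c∈C wt-c with odd k in odd-k
  ... | false = s∈C₀⊥ c (c∈C , trans (cong (_% 4) wt-c) (odd≡false⇒[k*2]%4≡0 k odd-k))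
  ... | true  with ∉⇒nonorthogonal s∉C
  ...   | d , d∈C , ⟨d,s⟩≡1 = xor-true (trans (sym (⟨⟩-distribʳ-⊕ s c d)) ⟨c⊕d,s⟩≡0)
    where
    open ≡-Reasoning
    xor-true : ⟨ c , s ⟩ xor ⟨ d , s ⟩ ≡ false → ⟨ c , s ⟩ ≡ true
    xor-true eq rewrite ⟨d,s⟩≡1 = trans (sym (Bool.not-involutive _))
      (cong not (trans (sym (Bool.xor-comm ⟨ c , s ⟩ true)) eq))
    l = proj₁ (half-weight d∈C)
    wt-d = proj₂ (half-weight d∈C)
    odd-l : odd l ≡ true
    odd-l = Bool.¬-not λ odd-l≡0 → case trans (sym ⟨d,s⟩≡1)
      (s∈C₀⊥ d (d∈C , trans (cong (_% 4) wt-d) (odd≡false⇒[k*2]%4≡0 l odd-l≡0))) of λ ()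
    c⊕d∈C = ⊕-closed C c∈C d∈C
    m = proj₁ (half-weight c⊕d∈C)
    wt-c⊕d = proj₂ (half-weight c⊕d∈C)
    w = wt (c ∩ d)
    m+w≡k+l : m ℕ.+ w ≡ k ℕ.+ l
    m+w≡k+l = ℕ.*-cancelʳ-≡ (m ℕ.+ w) (k ℕ.+ l) 2 (begin
      (m ℕ.+ w) ℕ.* 2             ≡⟨ ℕ.*-distribʳ-+ 2 m w ⟩
      m ℕ.* 2 ℕ.+ w ℕ.* 2         ≡⟨ cong (ℕ._+ w ℕ.* 2) wt-c⊕d ⟨
      wt (c ⊕ d) ℕ.+ w ℕ.* 2      ≡⟨ wt-⊕ c d ⟩
      wt c ℕ.+ wt d               ≡⟨ cong₂ ℕ._+_ wt-c wt-d ⟩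
      k ℕ.* 2 ℕ.+ l ℕ.* 2         ≡⟨ ℕ.*-distribʳ-+ 2 k l ⟨
      (k ℕ.+ l) ℕ.* 2             ∎)
    -- `w` is even because `c` and `d` are orthogonal, so half-weights add modulo 2.
    odd-m : odd m ≡ false
    odd-m = begin
      odd m                 ≡⟨ Bool.xor-identityʳ (odd m) ⟨
      odd m xor false       ≡⟨ cong (odd m xor_) (trans (sym (⟨⟩-odd c d)) (orthogonal c∈C d∈C)) ⟨
      odd m xor odd w       ≡⟨ odd-+ m w ⟨
      odd (m ℕ.+ w)         ≡⟨ cong odd m+w≡k+l ⟩
      odd (k ℕ.+ l)         ≡⟨ odd-+ k l ⟩
      odd k xor odd l       ≡⟨ cong₂ _xor_ odd-k odd-l ⟩
      false                 ∎
    ⟨c⊕d,s⟩≡0 : ⟨ c ⊕ d , s ⟩ ≡ false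
    ⟨c⊕d,s⟩≡0 = s∈C₀⊥ (c ⊕ d)
      (c⊕d∈C , trans (cong (_% 4) wt-c⊕d) (odd≡false⇒[k*2]%4≡0 m odd-m))

  -- `x` and `s` have the same inner product with each codeword, so their sum lies in the dual of
  -- `C`.
  shadow⇒coset : ∀ {s x} → s ∈ Shadow C → x ∈ Shadow C → x ⊕ s ∈ Codeword C
  shadow⇒coset {s} {x} s∈S x∈S = proj₂ selfDual λ c c∈C →
    let k , wt-c = half-weight c∈C in
    trans (⟨⟩-distribˡ-⊕ c x s)
      (trans (cong₂ _xor_ (shadow-⟨⟩ k x∈S c∈C wt-c) (shadow-⟨⟩ k s∈S c∈C wt-c)) (Bool.xor-same (odd k)))

  coset⇒shadow : ∀ {s x} → s ∈ Shadow C → x ⊕ s ∈ Codeword C → x ∈ Shadow C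
  coset⇒shadow {s} {x} (s∈C₀⊥ , s∉C) x⊕s∈C =
      (λ c c∈C₀ → trans (cong ⟨ c ,_⟩ (sym (⊕-cancelʳ x s)))
        (trans (⟨⟩-distribˡ-⊕ c (x ⊕ s) s)
          (cong₂ _xor_ (orthogonal (proj₁ c∈C₀) x⊕s∈C) (s∈C₀⊥ c c∈C₀))))
    , (λ x∈C → s∉C (⊕-cancelʳ-∈ x∈C
        (subst (Codeword C) (zipWith-comm Bool.xor-comm x s) x⊕s∈C)))

  -- Adding the codeword `ones` stays in the coset. This bounds the weights in the shadow from
  -- above.
  shadow-complement : ∀ {x} → x ∈ Shadow C → x ⊕ ones ∈ Shadow C
  shadow-complement {x} x∈S = coset⇒shadow x∈S (subst (Codeword C)
    (sym (trans (cong (_⊕ x) (zipWith-comm Bool.xor-comm x ones)) (⊕-cancelʳ ones x))) ones∈C)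

  -- The weight changes by `2 (k - w)`, where `k` is half the weight of `c`. Both `k` and `w` have
  -- the parity `⟨ c , s ⟩`, so this is a multiple of 4.
  wt-coset : ∀ {s c} → s ∈ Shadow C → c ∈ Codeword C → wt (c ⊕ s) % 4 ≡ wt s % 4
  wt-coset {s} {c} s∈S c∈C = begin
    -- Adding `w * 4` avoids subtraction of natural numbers.
    wt (c ⊕ s) % 4                    ≡⟨ [m+kn]%n≡m%n (wt (c ⊕ s)) w 4 ⟨
    (wt (c ⊕ s) ℕ.+ w ℕ.* 4) % 4      ≡⟨ cong (_% 4) eq ⟩
    (wt s ℕ.+ j ℕ.* 4) % 4            ≡⟨ [m+kn]%n≡m%n (wt s) j 4 ⟩
    wt s % 4                          ∎
    where
    open ≡-Reasoning
    w = wt (c ∩ s)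
    k = proj₁ (half-weight c∈C)
    wt-c = proj₂ (half-weight c∈C)
    odd-k+w : odd (k ℕ.+ w) ≡ false
    odd-k+w = begin
      odd (k ℕ.+ w)   ≡⟨ odd-+ k w ⟩
      odd k xor odd w ≡⟨ cong (odd k xor_) (trans (sym (⟨⟩-odd c s)) (shadow-⟨⟩ k s∈S c∈C wt-c)) ⟩
      odd k xor odd k ≡⟨ Bool.xor-same (odd k) ⟩
      false           ∎
    j = proj₁ (odd≡false⇒even (k ℕ.+ w) odd-k+w)
    k+w≡j*2 = proj₂ (odd≡false⇒even (k ℕ.+ w) odd-k+w)
    lemma₁ : ∀ a w → a ℕ.+ w ℕ.* 4 ≡ (a ℕ.+ w ℕ.* 2) ℕ.+ w ℕ.* 2
    lemma₁ = ℕ-Ring.solve-∀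
    lemma₂ : ∀ k b w → (k ℕ.* 2 ℕ.+ b) ℕ.+ w ℕ.* 2 ≡ b ℕ.+ (k ℕ.+ w) ℕ.* 2
    lemma₂ = ℕ-Ring.solve-∀
    lemma₃ : ∀ b j → b ℕ.+ (j ℕ.* 2) ℕ.* 2 ≡ b ℕ.+ j ℕ.* 4
    lemma₃ = ℕ-Ring.solve-∀
    eq : wt (c ⊕ s) ℕ.+ w ℕ.* 4 ≡ wt s ℕ.+ j ℕ.* 4
    eq = begin
      wt (c ⊕ s) ℕ.+ w ℕ.* 4                ≡⟨ lemma₁ (wt (c ⊕ s)) w ⟩
      (wt (c ⊕ s) ℕ.+ w ℕ.* 2) ℕ.+ w ℕ.* 2  ≡⟨ cong (ℕ._+ w ℕ.* 2) (wt-⊕ c s) ⟩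
      (wt c ℕ.+ wt s) ℕ.+ w ℕ.* 2           ≡⟨ cong (λ i → (i ℕ.+ wt s) ℕ.+ w ℕ.* 2) wt-c ⟩
      (k ℕ.* 2 ℕ.+ wt s) ℕ.+ w ℕ.* 2        ≡⟨ lemma₂ k (wt s) w ⟩
      wt s ℕ.+ (k ℕ.+ w) ℕ.* 2              ≡⟨ cong (λ i → wt s ℕ.+ i ℕ.* 2) k+w≡j*2 ⟩
      wt s ℕ.+ (j ℕ.* 2) ℕ.* 2              ≡⟨ lemma₃ (wt s) j ⟩
      wt s ℕ.+ j ℕ.* 4                      ∎

  -- The signed indicator of the shadow.

  module _ {s : F₂^ n} (s∈S : s ∈ Shadow C) (odd-s : odd (wt s) ≡ true) where

    -- The first factor is the indicator of the shadow, by `shadow⇒coset` and `coset⇒shadow`, in a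
    -- form to which `𝓕-indicator` applies.
    signed : F₂^ n → ℤ
    signed x = indicator (x ⊕ s) * χ ⟨ s , x ⟩

    ⟨s,s⟩≡1 : ⟨ s , s ⟩ ≡ true
    ⟨s,s⟩≡1 = trans (⟨⟩-self s) odd-s

    -- `signed` vanishes off the shadow.
    signed-cong : ∀ {i j} x → (x ∈ Shadow C → i ≡ j) → signed x * i ≡ signed x * j
    signed-cong {i} {j} x i≡j with codeword? C (x ⊕ s)
    ... | yes x⊕s∈C = cong (1ℤ * χ ⟨ s , x ⟩ *_) (i≡j (coset⇒shadow s∈S x⊕s∈C))
    ... | no  _     = refl

    -- The coset is preserved, and the sign changes by `χ ⟨ s , ones ⟩`, which is `-1ℤ` as `s` has
    -- odd weight.
    signed-complement : ∀ x → signed (x ⊕ ones) ≡ -1ℤ * signed x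
    signed-complement x = begin
      indicator ((x ⊕ ones) ⊕ s) * χ ⟨ s , x ⊕ ones ⟩
        ≡⟨ cong₂ _*_
             (trans (cong indicator (⊕-exchangeʳ x ones s)) (indicator-translate (x ⊕ s) ones∈C))
             (cong χ (trans (⟨⟩-distribˡ-⊕ s x ones)
               (cong (⟨ s , x ⟩ xor_) (trans (⟨⟩-ones s) odd-s)))) ⟩
      indicator (x ⊕ s) * χ (⟨ s , x ⟩ xor true)
        ≡⟨ cong (indicator (x ⊕ s) *_) (χ-xor ⟨ s , x ⟩ true) ⟩
      indicator (x ⊕ s) * (χ ⟨ s , x ⟩ * -1ℤ)
        ≡⟨ lemma (indicator (x ⊕ s)) (χ ⟨ s , x ⟩) ⟩
      -1ℤ * signed x ∎
      where
      open ≡-Reasoning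
      lemma : ∀ i j → i * (j * -1ℤ) ≡ -1ℤ * (i * j)
      lemma = solve-∀

    -- Substituting `x ⊕ s` for `x` turns the factor `χ ⟨ s , x ⟩` into a shift of the argument of
    -- `𝓕 indicator` by `s`. The minus sign is `χ ⟨ s , s ⟩`.
    𝓕-signed : ∀ z → 𝓕 signed z ≡ - size * signed z
    𝓕-signed z = begin
      𝓕 signed z
        ≡⟨ ∑-translate s (λ x → signed x * χ ⟨ x , z ⟩) ⟨
      ∑ (λ x → signed (x ⊕ s) * χ ⟨ x ⊕ s , z ⟩)
        ≡⟨ ∑-cong term ⟩
      ∑ (λ x → - χ ⟨ s , z ⟩ * (indicator x * χ ⟨ x , z ⊕ s ⟩))
        ≡⟨ *-distribˡ-∑ (- χ ⟨ s , z ⟩) (λ x → indicator x * χ ⟨ x , z ⊕ s ⟩) ⟨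
      - χ ⟨ s , z ⟩ * 𝓕 indicator (z ⊕ s)
        ≡⟨ cong (- χ ⟨ s , z ⟩ *_) (𝓕-indicator (z ⊕ s)) ⟩
      - χ ⟨ s , z ⟩ * (size * indicator (z ⊕ s))
        ≡⟨ lemma₂ (χ ⟨ s , z ⟩) size (indicator (z ⊕ s)) ⟩
      - size * signed z ∎
      where
      open ≡-Reasoning
      lemma₁ : ∀ i j k l → i * (j * -1ℤ) * (k * l) ≡ - l * (i * (k * j))
      lemma₁ = solve-∀
      lemma₂ : ∀ i j k → - i * (j * k) ≡ - j * (k * i)
      lemma₂ = solve-∀
      χ⟨s,x⊕s⟩ : ∀ x → χ ⟨ s , x ⊕ s ⟩ ≡ χ ⟨ x , s ⟩ * -1ℤ
      χ⟨s,x⊕s⟩ x = trans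
        (cong χ (trans (⟨⟩-distribˡ-⊕ s x s) (cong₂ _xor_ (⟨⟩-comm s x) ⟨s,s⟩≡1)))
        (χ-xor ⟨ x , s ⟩ true)
      term : ∀ x → signed (x ⊕ s) * χ ⟨ x ⊕ s , z ⟩ ≡
                   - χ ⟨ s , z ⟩ * (indicator x * χ ⟨ x , z ⊕ s ⟩)
      term x = begin
        indicator ((x ⊕ s) ⊕ s) * χ ⟨ s , x ⊕ s ⟩ * χ ⟨ x ⊕ s , z ⟩
          ≡⟨ cong₂ _*_ (cong₂ _*_ (cong indicator (⊕-cancelʳ x s)) (χ⟨s,x⊕s⟩ x))
               (trans (cong χ (⟨⟩-distribʳ-⊕ z x s)) (χ-xor ⟨ x , z ⟩ ⟨ s , z ⟩)) ⟩
        indicator x * (χ ⟨ x , s ⟩ * -1ℤ) * (χ ⟨ x , z ⟩ * χ ⟨ s , z ⟩)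
          ≡⟨ lemma₁ (indicator x) (χ ⟨ x , s ⟩) (χ ⟨ x , z ⟩) (χ ⟨ s , z ⟩) ⟩
        - χ ⟨ s , z ⟩ * (indicator x * (χ ⟨ x , z ⟩ * χ ⟨ x , s ⟩))
          ≡⟨ cong (λ i → - χ ⟨ s , z ⟩ * (indicator x * i))
               (trans (cong χ (⟨⟩-distribˡ-⊕ x z s)) (χ-xor ⟨ x , z ⟩ ⟨ x , s ⟩)) ⟨
        - χ ⟨ s , z ⟩ * (indicator x * χ ⟨ x , z ⊕ s ⟩) ∎

    -- Moving the transform across the pairing gives `- size * X ≡ + M * (X + X)`, and `size + 2M`
    -- is positive because `size` counts codewords.
    ∑-signed≡0 : ∀ M .{{_ : ℕ.NonZero M}} (q h : F₂^ n → ℤ) →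
      (∀ {x} → x ∈ Shadow C → 𝓕 q x ≡ + M * (h x - h (x ⊕ ones))) →
      (∀ {x} → x ∈ Shadow C → q x ≡ h x) →
      ∑ (λ x → signed x * h x) ≡ 0ℤ
    ∑-signed≡0 M q h 𝓕q≡ q≡h = [size+2M]*i≡0⇒i≡0 (begin
      - size * X
        ≡⟨ *-distribˡ-∑ (- size) (λ x → signed x * h x) ⟩
      ∑ (λ x → - size * (signed x * h x))
        ≡⟨ ∑-cong (λ x → trans (cong (- size *_) (signed-cong x (sym ∘ q≡h)))
             (trans (lemma₁ (- size) (signed x) (q x)) (cong (q x *_) (sym (𝓕-signed x))))) ⟩
      ∑ (λ x → q x * 𝓕 signed x)
        ≡⟨ 𝓕-adjoint q signed ⟩
      ∑ (λ x → signed x * 𝓕 q x)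
        ≡⟨ ∑-cong (λ x → signed-cong x 𝓕q≡) ⟩
      ∑ (λ x → signed x * (+ M * (h x - h (x ⊕ ones))))
        -- The minus sign before `h (x ⊕ ones)` is absorbed by `signed-complement`; translation by
        -- `ones` then makes the second sum equal to `X`.
        ≡⟨ ∑-cong (λ x → trans (lemma₂ (+ M) (signed x) (h x) (h (x ⊕ ones)))
             (cong (λ i → + M * (signed x * h x + i * h (x ⊕ ones))) (sym (signed-complement x)))) ⟩
      ∑ (λ x → + M * (signed x * h x + signed (x ⊕ ones) * h (x ⊕ ones)))
        ≡⟨ *-distribˡ-∑ (+ M) (λ x → signed x * h x + signed (x ⊕ ones) * h (x ⊕ ones)) ⟨
      + M * ∑ (λ x → signed x * h x + signed (x ⊕ ones) * h (x ⊕ ones))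
        ≡⟨ cong (+ M *_) (trans (∑-distrib-+ (λ x → signed x * h x) (λ x → signed (x ⊕ ones) * h (x ⊕ ones)))
             (cong (λ i → X + i) (∑-translate ones (λ x → signed x * h x)))) ⟩
      + M * (X + X) ∎)
      where
      open ≡-Reasoning
      X = ∑ (λ x → signed x * h x)
      lemma₁ : ∀ i j k → i * (j * k) ≡ k * (i * j)
      lemma₁ = solve-∀
      lemma₂ : ∀ i j k l → j * (i * (k - l)) ≡ i * (j * k + -1ℤ * j * l)
      lemma₂ = solve-∀
      [size+2M]*i≡0⇒i≡0 : ∀ {i} → - size * i ≡ + M * (i + i) → i ≡ 0ℤ
      [size+2M]*i≡0⇒i≡0 {i} eq = ℤ.*-cancelˡ-≡ (+ (k ℕ.+ 2 ℕ.* M)) i 0ℤ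
        {{ℕ.>-nonZero (ℕ.≤-trans (ℕ.>-nonZero⁻¹ M) (ℕ.≤-trans (ℕ.m≤m+n M _) (ℕ.m≤n+m _ k)))}} (begin
          (+ k + + (2 ℕ.* M)) * i
            ≡⟨ cong (λ j → (+ k + j) * i) (ℤ.pos-* 2 M) ⟩
          (+ k + + 2 * + M) * i
            ≡⟨ cong (λ j → (j + + 2 * + M) * i) (length-filter-allVectors (codeword? C)) ⟩
          (size + + 2 * + M) * i
            ≡⟨ lemma₃ size (+ M) i ⟩
          - (- size * i) + + M * (i + i)
            ≡⟨ cong (λ j → - j + + M * (i + i)) eq ⟩
          - (+ M * (i + i)) + + M * (i + i)
            ≡⟨ ℤ.+-inverseˡ (+ M * (i + i)) ⟩
          0ℤ
            ≡⟨ ℤ.*-zeroʳ (+ (k ℕ.+ 2 ℕ.* M)) ⟨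
          + (k ℕ.+ 2 ℕ.* M) * 0ℤ ∎)
        where
        k = length (filter (codeword? C) (allVectors n))
        lemma₃ : ∀ a m i → (a + + 2 * m) * i ≡ - (- a * i) + m * (i + i)
        lemma₃ = solve-∀

    -- `signed` is 1 or -1 on the shadow, so modulo 2 the vanishing sum is the sum of `h` over the
    -- shadow, which is the count.
    even-shadow-count : ∀ k (h : F₂^ n → ℤ) →
      (∀ {x} → x ∈ Shadow C → + 2 Signed.∣ 𝟙 (wt x ℕ.≟ k) + h x) →
      ∑ (λ x → signed x * h x) ≡ 0ℤ →
      + 2 Signed.∣ + countOfWeight (shadow? C) k
    even-shadow-count k h 2∣ ∑≡0 = subst (+ 2 Signed.∣_) eq (∑-∣ (+ 2) term)
      where
      open ≡-Reasoning
      g : F₂^ n → ℤ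
      g x = 𝟙 (shadow? C x ×-dec (wt x ℕ.≟ k))
      lemma : ∀ i j → (i + j) + + 2 * (-1ℤ * j) ≡ i + -1ℤ * j
      lemma = solve-∀
      sign : ∀ b i j → + 2 Signed.∣ i + j → + 2 Signed.∣ i + χ b * j
      sign false i j 2∣i+j = subst (λ k → + 2 Signed.∣ i + k) (sym (ℤ.*-identityˡ j)) 2∣i+j
      sign true  i j 2∣i+j = subst (+ 2 Signed.∣_) (lemma i j)
        (Signed.∣m∣n⇒∣m+n 2∣i+j (Signed.∣m⇒∣m*n (-1ℤ * j) (Signed.∣-refl {+ 2})))
      term : ∀ x → + 2 Signed.∣ g x + signed x * h x
      term x = case shadow? C x of λ where
        (yes x∈S) → subst (+ 2 Signed.∣_)
          (sym (cong₂ (λ i j → i + j * h x)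
            (𝟙-⇔ (shadow? C x ×-dec (wt x ℕ.≟ k)) (wt x ℕ.≟ k) proj₂ (x∈S ,_))
            (trans (cong (_* χ ⟨ s , x ⟩) (𝟙-true (codeword? C (x ⊕ s)) (shadow⇒coset s∈S x∈S)))
                   (ℤ.*-identityˡ (χ ⟨ s , x ⟩)))))
          (sign ⟨ s , x ⟩ (𝟙 (wt x ℕ.≟ k)) (h x) (2∣ x∈S))
        (no x∉S) → subst (+ 2 Signed.∣_)
          (sym (cong₂ (λ i j → i + j * χ ⟨ s , x ⟩ * h x)
            (𝟙-false (shadow? C x ×-dec (wt x ℕ.≟ k)) (x∉S ∘ proj₁))
            (𝟙-false (codeword? C (x ⊕ s)) (x∉S ∘ coset⇒shadow s∈S))))
          (Signed.divides 0ℤ refl)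
      eq : ∑ (λ x → g x + signed x * h x) ≡ + countOfWeight (shadow? C) k
      eq = begin
        ∑ (λ x → g x + signed x * h x)          ≡⟨ ∑-distrib-+ g (λ x → signed x * h x) ⟩
        ∑ g + ∑ (λ x → signed x * h x)          ≡⟨ cong (λ i → ∑ g + i) ∑≡0 ⟩
        ∑ g + 0ℤ                                ≡⟨ ℤ.+-identityʳ (∑ g) ⟩
        ∑ g                                     ≡⟨ length-filter-allVectors (λ x → shadow? C x ×-dec (wt x ℕ.≟ k)) ⟨
        + countOfWeight (shadow? C) k           ∎

-- Reduction to a finite check on weights, and its evaluation for length 58.

record Certificate (n M : ℕ) (q h : List ℤ) (i : ℕ) : Set where
  constructor certificate
  field
    transform : coeff (krawtchouk q (n ℕ.∸ i) i) 0 ≡ + M * (coeff h i - coeff h (n ℕ.∸ i))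
    agree     : coeff q i ≡ coeff h i
    parity    : + 2 Signed.∣ 𝟙 (i ℕ.≟ 9) + coeff h i

open Certificate

-- At weight `i` the hypotheses on `q` and `h` become statements about integers, with `n ∸ i` the
-- weight of the complement; hence they can be settled by evaluation.
certificate? : ∀ n M q h i → Dec (Certificate n M q h i)
certificate? n M q h i = map′ (λ (t , a , p) → certificate t a p)
  (λ c → transform c , agree c , parity c)
  (     (coeff (krawtchouk q (n ℕ.∸ i) i) 0 ℤ.≟ + M * (coeff h i - coeff h (n ℕ.∸ i)))
  ×-dec (coeff q i ℤ.≟ coeff h i)
  ×-dec (+ 2 Signed.∣? (𝟙 (i ℕ.≟ 9) + coeff h i)))

even-shadow-count-9 : ∀ {n} M .{{_ : ℕ.NonZero M}} (q h : List ℤ) →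
  (∀ {i} → 5 ≤ i → i ℕ.+ 5 ≤ n → i % 4 ≡ 1 → Certificate n M q h i) →
  (C : Code n) → SelfDual C → (∀ v → v ∈ Shadow C → 5 ≤ wt v) →
  + 2 ∣ + countOfWeight (shadow? C) 9
even-shadow-count-9 {n} M q h certified C selfDual 5≤wt
  with anySubset? (λ x → shadow? C x ×-dec (wt x ℕ.≟ 9))
-- The count is a sum of zeros.
... | no none = Signed.∣⇒∣ᵤ (subst (+ 2 Signed.∣_)
  (sym (length-filter-allVectors (λ x → shadow? C x ×-dec (wt x ℕ.≟ 9))))
  (∑-∣ (+ 2) λ x → subst (+ 2 Signed.∣_)
    (sym (𝟙-false (shadow? C x ×-dec (wt x ℕ.≟ 9)) (λ p → none (x , p)))) (Signed.divides 0ℤ refl)))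
... | yes (s , s∈S , wt-s≡9) = Signed.∣⇒∣ᵤ
  (even-shadow-count s∈S odd-s 9 (coeff h ∘ wt) (parity ∘ certified-wt)
    (∑-signed≡0 s∈S odd-s M (coeff q ∘ wt) (coeff h ∘ wt) 𝓕q (agree ∘ certified-wt)))
  where
  open SelfDualCode C selfDual
  odd-s : odd (wt s) ≡ true
  odd-s = cong odd wt-s≡9
  wt-complement≡∸ : ∀ x → wt (x ⊕ ones) ≡ n ℕ.∸ wt x
  wt-complement≡∸ x = trans (sym (ℕ.m+n∸m≡n (wt x) _)) (cong (ℕ._∸ wt x) (wt-complement x))
  -- The complement also has weight at least 5, so `wt x + 5 ≤ n`; and all weights in the coset
  -- agree with 9 modulo 4.
  certified-wt : ∀ {x} → x ∈ Shadow C → Certificate n M q h (wt x)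
  certified-wt {x} x∈S = certified (5≤wt x x∈S)
    (ℕ.≤-trans (ℕ.+-monoʳ-≤ (wt x) (5≤wt _ (shadow-complement x∈S)))
               (ℕ.≤-reflexive (wt-complement x)))
    (trans (cong (λ y → wt y % 4) (sym (⊕-cancelʳ x s)))
      (trans (wt-coset s∈S (shadow⇒coset s∈S x∈S)) (cong (_% 4) wt-s≡9)))
  𝓕q : ∀ {x} → x ∈ Shadow C →
    𝓕 (coeff q ∘ wt) x ≡ + M * (coeff h (wt x) - coeff h (wt (x ⊕ ones)))
  𝓕q {x} x∈S = trans (𝓕-krawtchouk q x)
    (subst (λ m → coeff (krawtchouk q m (wt x)) 0 ≡ + M * (coeff h (wt x) - coeff h m))
      (sym (wt-complement≡∸ x)) (transform (certified-wt x∈S)))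

-- K₉ + 10 K₅ + 55 K₁ for length 58 vanishes at 13, 17, …, 45, and takes the
-- values 2²⁷ and 10 · 2²⁷ at 9 and 5, with opposite signs at 49 and 53.
q₅₈ h₅₈ : List ℤ
q₅₈ = + 0 ∷ + 55 ∷ + 0 ∷ + 0 ∷ + 0 ∷ + 10 ∷ + 0 ∷ + 0 ∷ + 0 ∷ + 1 ∷ []
h₅₈ = + 0 ∷ + 0 ∷ + 0 ∷ + 0 ∷ + 0 ∷ + 10 ∷ + 0 ∷ + 0 ∷ + 0 ∷ + 1 ∷ []

-- Only the weights 5, 9, ..., 53 meet the premises; all are checked by computation.
certified₅₈ : ∀ {i} → 5 ≤ i → i ℕ.+ 5 ≤ 58 → i % 4 ≡ 1 → Certificate 58 (2 ℕ.^ 27) q₅₈ h₅₈ i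
certified₅₈ {i} 5≤i i+5≤58 = subst
  (λ i → 5 ≤ i → i % 4 ≡ 1 → Certificate 58 (2 ℕ.^ 27) q₅₈ h₅₈ i) (toℕ-fromℕ< i<54)
  (certified (fromℕ< i<54)) 5≤i
  where
  i<54 : i < 54
  i<54 = ℕ.+-cancelʳ-≤ 5 (suc i) 54 (ℕ.s≤s i+5≤58)
  certified : ∀ (i : Fin 54) → 5 ≤ toℕ i → toℕ i % 4 ≡ 1 →
    Certificate 58 (2 ℕ.^ 27) q₅₈ h₅₈ (toℕ i)
  certified = from-yes (all? {n = 54} λ i →
    (5 ℕ.≤? toℕ i) →-dec (toℕ i % 4 ℕ.≟ 1) →-dec certificate? 58 (2 ℕ.^ 27) q₅₈ h₅₈ (toℕ i))

theorem1 : (C : Code 58) →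
    SelfDual C →
    HasDimension C 29 →
    HasMinimumWeight C 10 →
    Optimal C →
    SinglyEven C →
    (∀ v → v ∈ Shadow C → 5 ≤ wt v) →
    (β γ : ℤ) →
    weightEnumerator (codeword? C)
    ≈ (+ 1) y^ 0
    ⊞ (+ 319 - + 24 * β - + 2 * γ) y^ 10
    ⊞ (+ 3132 + + 152 * β + + 2 * γ) y^ 12
    +O[y^ 13 ] →
    weightEnumerator (shadow? C)
    ≈ β y^ 5
    ⊞ γ y^ 9
    ⊞ (+ 24128 - + 54 * β - + 10 * γ) y^ 13
    ⊞ (+ 1469952 + + 320 * β + + 45 * γ) y^ 17
    +O[y^ 18 ] →
    + 2 ∣ γ
theorem1 C selfDual _ _ _ _ 5≤wt β γ _ W_S = subst (+ 2 ∣_) count≡γ 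
  (even-shadow-count-9 (2 ℕ.^ 27) q₅₈ h₅₈ certified₅₈ C selfDual 5≤wt)
  where
  lemma : ∀ i → 0ℤ + i + 0ℤ + 0ℤ ≡ i
  lemma = solve-∀
  count≡γ : + countOfWeight (shadow? C) 9 ≡ γ
  -- The proof of `9 < 18` is `10 ≤ 10 + 8`. At degree 9 the other three displayed terms contribute
  -- zero.
  count≡γ = trans (W_S 9 (ℕ.m≤m+n 10 8)) (lemma γ)
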